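{- Any (probabilistic bounded error or deterministic) symbolic algorithm that, given an undirected connected graph with $n$ vertices whose diameter is either $2$ or $3$, decides which of the two is the case needs $\Omega(n)$ symbolic one-step operations.
   Context: Symbolic model: the input is a finite graph $G=(V,E)$, $n=|V|$; an undirected graph is regarded as a directed graph with symmetric edge relation. The algorithm knows $V$, but it can access $E$ only through the one-step operations $\mathrm{Pre}(S)=\{v\in V\mid \exists s\in S:(v,s)\in E\}$ and $\mathrm{Post}(S)=\{v\in V\mid \exists s\in S:(s,v)\in E\}$ (equal for undirected graphs) applied to (adaptively chosen) sets $S\subseteq V$. All other computation, in particular basic set operations on vertex sets, is unrestricted and not counted in lower bounds; any number of sets may be stored. A probabilistic bounded error algorithm may use random bits and must be correct with probability at least $2/3$ on every admissible input (here: every undirected connected graph of diameter $2$ or $3$). The diameter of a connected undirected graph is the maximum distance between two of its vertices. Convention for lower bounds: "needs $\Omega(n)$ one-step operations" means: there is an absolute constant $c>0$ such that every (deterministic or probabilistic bounded error) symbolic algorithm that is correct on all admissible inputs performs, on admissible inputs with arbitrarily large $n$, at least $c\cdot n$ one-step operations (worst case over its random choices). -}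

module Defs where

open import Data.Bool using (Bool; true; false)
open import Data.Fin using (Fin)
open import Data.Fin.Properties using (any?)
open import Data.Fin.Subset using (Subset; _∈_)
open import Data.Fin.Subset.Properties using (_∈?_)
open import Data.Integer using (+_)
open import Data.List using (List; []; _∷_; [_]; _++_; map; length; filter)
open import Data.Maybe using (Maybe; just; nothing)
open import Data.Maybe.Properties using (≡-dec)
open import Data.Nat using (ℕ; zero; suc; _+_; _^_; _≤_)
open import Data.Nat.Properties using (_≟_; m^n≢0)
open import Data.Product using (∃; _×_)
open import Data.Rational as ℚ using (ℚ; 0ℚ; _/_)
open import Data.Sum using (_⊎_)
open import Data.Vec as Vec using (Vec; tabulate)
open import Level using (0ℓ)
open import Relation.Binary.Core using (Rel)
open import Relation.Binary.Definitions using (Decidable; Symmetric; Irreflexive)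
open import Relation.Binary.PropositionalEquality using (_≡_; _≢_)
open import Relation.Nullary.Decidable using (does; _×-dec_)

-- Directed graphs on the vertex set V = Fin n.
record Graph (n : ℕ) : Set₁ where
  field
    E  : Rel (Fin n) 0ℓ
    E? : Decidable E

open Graph public

Pre : ∀ {n} → Graph n → Subset n → Subset n
Pre G S = tabulate λ v → does (any? λ s → (s ∈? S) ×-dec E? G v s)

Post : ∀ {n} → Graph n → Subset n → Subset n
Post G S = tabulate λ v → does (any? λ s → (s ∈? S) ×-dec E? G s v)

-- The last index is the number of edges.
data Walk {n : ℕ} (G : Graph n) : Fin n → Fin n → ℕ → Set where
  []  : ∀ {u} → Walk G u u 0
  _∷_ : ∀ {u v w k} → E G u v → Walk G v w k → Walk G u w (suc k)

Connected : ∀ {n} → Graph n → Set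
Connected G = ∀ u v → ∃ λ k → Walk G u v k

IsDistance : ∀ {n} → Graph n → Fin n → Fin n → ℕ → Set
IsDistance G u v d = Walk G u v d × (∀ k → Walk G u v k → d ≤ k)

IsDiameter : ∀ {n} → Graph n → ℕ → Set
IsDiameter G d =
  (∃ λ u → ∃ λ v → IsDistance G u v d) ×
  (∀ u v k → IsDistance G u v k → k ≤ d)

-- Undirected graphs are simple.  Excluding self-loops only shrinks the class of
-- inputs on which an algorithm has to be correct and from which a costly input
-- may be taken, so a lower bound for this class implies the one with self-loops.
record Admissible {n : ℕ} (G : Graph n) (d : ℕ) : Set where
  field
    symmetric : Symmetric (E G)
    loopless  : Irreflexive _≡_ (E G)
    connected : Connected G
    diameter  : IsDiameter G d
    2or3      : d ≡ 2 ⊎ d ≡ 3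

data Request (n : ℕ) : Set where
  pre post : Subset n → Request n
  toss     : Request n

data Response (n : ℕ) : Set where
  set  : Subset n → Response n
  coin : Bool → Response n

-- `halt d` announces the answer "the diameter is d".
data Action (n : ℕ) : Set where
  halt    : ℕ → Action n
  perform : Request n → Action n

-- The responses received so far, most recent first.
History : ℕ → Set
History n = List (Response n)

-- Since computation other than one-step operations and memory are unrestricted,
-- an algorithm is a rule choosing the next action from n and all responses
-- received so far.  Nothing forces it to halt, and it may toss any number of coins.
SymbolicAlgorithm : Set
SymbolicAlgorithm = ∀ n → History n → Action n

respond : ∀ {n} → Graph n → Request n → Bool → Response n
respond G (pre S)  b = set (Pre G S)
respond G (post S) b = set (Post G S)
respond G toss     b = coin b

cost : ∀ {n} → Request n → ℕ
cost (pre S)  = 1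
cost (post S) = 1
cost toss     = 0

-- Runs are cut off after t actions.  The i-th random bit is the one offered to
-- the i-th action; it is discarded unless that action is a coin toss.
verdict : ∀ {n t} → SymbolicAlgorithm → Graph n → History n → Vec Bool t → Maybe ℕ
verdict A G h Vec.[] = nothing
verdict {n} A G h (b Vec.∷ ω) with A n h
... | halt d    = just d
... | perform q = verdict A G (respond G q b ∷ h) ω

operations : ∀ {n t} → SymbolicAlgorithm → Graph n → History n → Vec Bool t → ℕ
operations A G h Vec.[] = 0
operations {n} A G h (b Vec.∷ ω) with A n h
... | halt d    = 0
... | perform q = cost q + operations A G (respond G q b ∷ h) ω

bitStrings : ∀ t → List (Vec Bool t)
bitStrings zero    = [ Vec.[] ]
bitStrings (suc t) =
  map (false Vec.∷_) (bitStrings t) ++ map (true Vec.∷_) (bitStrings t)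

-- The probability, over t uniform random bits, of having answered d within t actions.
probability : ∀ {n} → SymbolicAlgorithm → Graph n → ℕ → ℕ → ℚ
probability A G d t =
  _/_ (+ length (filter (λ ω → ≡-dec _≟_ (verdict A G [] ω) (just d)) (bitStrings t)))
      (2 ^ t) ⦃ m^n≢0 2 t ⦄

-- `probability A G d t` is nondecreasing in t and its limit is the probability
-- that A ever answers d; the last line says that this limit is at least 2/3.
DecidesBoundedError : SymbolicAlgorithm → Set₁
DecidesBoundedError A =
  ∀ n (G : Graph n) d → Admissible G d →
  ∀ ε → 0ℚ ℚ.< ε → ∃ λ t → (+ 2 / 3) ℚ.- ε ℚ.≤ probability A G d t

DecidesDeterministically : SymbolicAlgorithm → Set₁
DecidesDeterministically A =
  (∀ n h → A n h ≢ perform toss) ×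
  (∀ n (G : Graph n) d → Admissible G d →
   ∃ λ t → ∀ (ω : Vec Bool t) → verdict A G [] ω ≡ just d)

fromℕ : ℕ → ℚ
fromℕ k = + k / 1

{-# OPTIONS --safe #-}
-- The complete bipartite graph K(m,m) has diameter 2, and deleting any of its
-- m² edges gives diameter 3.  If the edge between the left vertex i and the
-- right vertex j is deleted, then Pre(S) = Post(S) changes only if i is the only
-- left vertex in S or j is the only right vertex in S, so one operation tells
-- K(m,m) apart from at most 2m of the m² graphs with a deleted edge.  A bounded
-- error algorithm run with the same coins on K(m,m) and on K(m,m) - e must, for
-- every e, give different answers for a constant fraction of the coin strings.
-- Averaging over e and the coins yields a coin string that makes the algorithm
-- perform at least m/8 operations on K(m,m).
module Submission where

open import Defs
open import Data.Bool using (Bool; true; false)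
open import Data.Empty using (⊥)
open import Data.Fin using (Fin; zero; suc; splitAt; _↑ˡ_; _↑ʳ_)
open import Data.Fin.Properties
  using (all?; any?; ¬∀⟶∃¬; join-splitAt; splitAt-↑ˡ; splitAt-↑ʳ; ↑ˡ-injective; punchInᵢ≢i)
  renaming (_≟_ to _≟ᶠ_)
open import Data.Fin.Subset using (Subset; _∈_)
open import Data.Fin.Subset.Properties using (_∈?_)
open import Data.Integer as ℤ using (+_)
import Data.Integer.Properties as ℤ
open import Data.List using (List; []; _∷_; _++_; map; length; filter; allFin)
open import Data.List.Properties using (map-++; map-∘; length-tabulate)
open import Data.List.Relation.Unary.All as All using (All; []; _∷_)
open import Data.List.Relation.Unary.AllPairs using ([]; _∷_)
open import Data.List.Relation.Unary.Unique.Propositional using (Unique)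
open import Data.List.Relation.Unary.Unique.Propositional.Properties using (allFin⁺)
open import Data.Maybe using (Maybe; just; nothing)
open import Data.Maybe.Properties using (≡-dec; just-injective)
open import Data.Nat using (ℕ; zero; suc; _+_; _*_; _^_; _≤_; _<_; z≤n; s≤s; NonZero; >-nonZero)
open import Data.Nat.ListAction using (sum)
open import Data.Nat.ListAction.Properties using (sum-++)
open import Data.Nat.Properties
open import Data.Nat.Tactic.RingSolver using (solve-∀)
open import Data.Product using (∃; _×_; _,_; proj₁; proj₂)
open import Data.Rational as ℚ using (ℚ; 0ℚ; _/_; toℚᵘ)
import Data.Rational.Properties as ℚ
open import Data.Rational.Unnormalised as ℚᵘ using (mkℚᵘ; *≤*)
import Data.Rational.Unnormalised.Properties as ℚᵘ
open import Data.Sum using (_⊎_; inj₁; inj₂)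
open import Data.Unit using (⊤; tt)
open import Data.Vec using (Vec) renaming ([] to []ᵛ; _∷_ to _∷ᵛ_)
open import Data.Vec.Properties using (tabulate-cong)
open import Function using (_∘_; id; mk⇔)
open import Level using (0ℓ)
open import Relation.Binary.Core using (REL)
import Relation.Binary.Definitions as B
open import Relation.Binary.PropositionalEquality
open import Relation.Nullary using (¬_; Dec; yes; no; contradiction)
open import Relation.Nullary.Decidable using (does-⇔; ¬?; _×-dec_; _⊎-dec_; _→-dec_)
open import Relation.Unary using (Pred; Decidable)

-- Sums over lists

∑ : {X : Set} → List X → (X → ℕ) → ℕ
∑ xs f = sum (map f xs)

∑-cong : ∀ {X : Set} (xs : List X) {f g} → (∀ x → f x ≡ g x) → ∑ xs f ≡ ∑ xs g
∑-cong []       f≗g = refl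
∑-cong (x ∷ xs) f≗g = cong₂ _+_ (f≗g x) (∑-cong xs f≗g)

∑-mono : ∀ {X : Set} (xs : List X) {f g} → (∀ x → f x ≤ g x) → ∑ xs f ≤ ∑ xs g
∑-mono []       f≤g = z≤n
∑-mono (x ∷ xs) f≤g = +-mono-≤ (f≤g x) (∑-mono xs f≤g)

∑-const : ∀ {X : Set} (xs : List X) k → ∑ xs (λ _ → k) ≡ length xs * k
∑-const []       k = refl
∑-const (x ∷ xs) k = cong (_+_ k) (∑-const xs k)

∑-+ : ∀ {X : Set} (xs : List X) f g → ∑ xs (λ x → f x + g x) ≡ ∑ xs f + ∑ xs g
∑-+ []       f g = refl
∑-+ (x ∷ xs) f g = trans (cong (_+_ _) (∑-+ xs f g)) (interchange (f x) (g x) _ _)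
  where
  interchange : ∀ a b c d → (a + b) + (c + d) ≡ (a + c) + (b + d)
  interchange = solve-∀

∑-*ˡ : ∀ {X : Set} (xs : List X) k f → ∑ xs (λ x → k * f x) ≡ k * ∑ xs f
∑-*ˡ []       k f = sym (*-zeroʳ k)
∑-*ˡ (x ∷ xs) k f = trans (cong (_+_ _) (∑-*ˡ xs k f)) (sym (*-distribˡ-+ k (f x) _))

∑-swap : ∀ {X Y : Set} (xs : List X) (ys : List Y) (f : X → Y → ℕ) →
  ∑ xs (λ x → ∑ ys (f x)) ≡ ∑ ys (λ y → ∑ xs (λ x → f x y))
∑-swap []       ys f = sym (trans (∑-const ys 0) (*-zeroʳ (length ys)))
∑-swap (x ∷ xs) ys f = trans (cong (_+_ _) (∑-swap xs ys f)) (sym (∑-+ ys (f x) _))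

-- The strict hypothesis excludes the empty list by itself, so the induction carries no condition on
-- the length. The averaging principle `∑-≤⇒∃-≤` falls back on it: a first entry that fails makes
-- the inequality between the tails strict.
∑-<⇒∃-≤ : ∀ {X : Set} (xs : List X) f g → ∑ xs f < ∑ xs g → ∃ λ x → f x ≤ g x
∑-<⇒∃-≤ (x ∷ xs) f g lt with f x ≤? g x
... | yes le = x , le
... | no ¬le = ∑-<⇒∃-≤ xs f g
  (+-cancelˡ-< (g x) _ _ (≤-<-trans (+-monoˡ-≤ _ (<⇒≤ (≰⇒> ¬le))) lt))

∑-≤⇒∃-≤ : ∀ {X : Set} (xs : List X) f g → 0 < length xs → ∑ xs f ≤ ∑ xs g →
  ∃ λ x → f x ≤ g x
∑-≤⇒∃-≤ (x ∷ xs) f g _ le with f x ≤? g x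
... | yes le′ = x , le′
... | no ¬le  = ∑-<⇒∃-≤ xs f g
  (+-cancelˡ-< (g x) _ _ (<-≤-trans (+-monoˡ-< _ (≰⇒> ¬le)) le))

-- Indicators of decidable propositions

𝟙 : ∀ {p} {P : Set p} → Dec P → ℕ
𝟙 (yes _) = 1
𝟙 (no  _) = 0

𝟙≤1 : ∀ {p} {P : Set p} (P? : Dec P) → 𝟙 P? ≤ 1
𝟙≤1 (yes _) = ≤-refl
𝟙≤1 (no  _) = z≤n

𝟙-true : ∀ {p} {P : Set p} (P? : Dec P) → P → 𝟙 P? ≡ 1
𝟙-true (yes _)  p = refl
𝟙-true (no ¬p) p = contradiction p ¬p

𝟙-false : ∀ {p} {P : Set p} (P? : Dec P) → ¬ P → 𝟙 P? ≡ 0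
𝟙-false (yes p) ¬p = contradiction p ¬p
𝟙-false (no  _) ¬p = refl

length-filter≡∑ : ∀ {p} {X : Set} {P : Pred X p} (P? : Decidable P) xs →
  length (filter P? xs) ≡ ∑ xs (λ x → 𝟙 (P? x))
length-filter≡∑ P? []       = refl
length-filter≡∑ P? (x ∷ xs) with P? x
... | yes _ = cong suc (length-filter≡∑ P? xs)
... | no  _ = length-filter≡∑ P? xs

∑-𝟙-false : ∀ {p} {X : Set} {P : Pred X p} (P? : Decidable P) {xs} →
  All (¬_ ∘ P) xs → ∑ xs (λ x → 𝟙 (P? x)) ≡ 0
∑-𝟙-false P? []         = refl
∑-𝟙-false P? (¬p ∷ ¬ps) = cong₂ _+_ (𝟙-false (P? _) ¬p) (∑-𝟙-false P? ¬ps)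

∑-𝟙-unique : ∀ {p} {X : Set} {P : Pred X p} (P? : Decidable P) →
  (∀ {x y} → P x → P y → x ≡ y) →
  ∀ {xs} → Unique xs → ∑ xs (λ x → 𝟙 (P? x)) ≤ 1
∑-𝟙-unique P? unique []                    = z≤n
∑-𝟙-unique P? unique {x ∷ xs} (x∉xs ∷ uxs) with P? x
... | yes px = ≤-reflexive (cong suc (∑-𝟙-false P? (All.map (λ x≢y py → x≢y (unique px py)) x∉xs)))
... | no  _  = ∑-𝟙-unique P? unique uxs

-- Sums over coin strings

∑-bitStrings : ∀ t (f : Vec Bool (suc t) → ℕ) →
  ∑ (bitStrings (suc t)) f ≡
  ∑ (bitStrings t) (λ ω → f (false ∷ᵛ ω)) + ∑ (bitStrings t) (λ ω → f (true ∷ᵛ ω))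
∑-bitStrings t f = begin
  sum (map f (map (false ∷ᵛ_) ts ++ map (true ∷ᵛ_) ts))
    ≡⟨ cong sum (map-++ f (map (false ∷ᵛ_) ts) _) ⟩
  sum (map f (map (false ∷ᵛ_) ts) ++ map f (map (true ∷ᵛ_) ts))
    ≡⟨ sum-++ (map f (map (false ∷ᵛ_) ts)) _ ⟩
  sum (map f (map (false ∷ᵛ_) ts)) + sum (map f (map (true ∷ᵛ_) ts))
    ≡⟨ cong₂ (λ xs ys → sum xs + sum ys) (map-∘ ts) (map-∘ ts) ⟨
  ∑ ts (λ ω → f (false ∷ᵛ ω)) + ∑ ts (λ ω → f (true ∷ᵛ ω)) ∎
  where
  open ≡-Reasoning
  ts = bitStrings t

length≡∑ : ∀ {X : Set} (xs : List X) → length xs ≡ ∑ xs (λ _ → 1)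
length≡∑ xs = sym (trans (∑-const xs 1) (*-identityʳ _))

length-bitStrings : ∀ t → length (bitStrings t) ≡ 2 ^ t
length-bitStrings zero    = refl
length-bitStrings (suc t) = begin
  length (bitStrings (suc t))                             ≡⟨ length≡∑ (bitStrings (suc t)) ⟩
  ∑ (bitStrings (suc t)) (λ _ → 1)                        ≡⟨ ∑-bitStrings t (λ _ → 1) ⟩
  ∑ (bitStrings t) (λ _ → 1) + ∑ (bitStrings t) (λ _ → 1) ≡⟨ cong₂ _+_ eq (trans eq (sym (+-identityʳ _))) ⟩
  2 ^ suc t                                               ∎
  where
  open ≡-Reasoning
  eq = trans (sym (length≡∑ (bitStrings t))) (length-bitStrings t)

-- Bipartite graphs

cross : ∀ {m} → REL (Fin m) (Fin m) 0ℓ → Fin m ⊎ Fin m → Fin m ⊎ Fin m → Set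
cross r (inj₁ a) (inj₂ b) = r a b
cross r (inj₂ b) (inj₁ a) = r a b
cross r (inj₁ _) (inj₁ _) = ⊥
cross r (inj₂ _) (inj₂ _) = ⊥

cross? : ∀ {m} {r : REL (Fin m) (Fin m) 0ℓ} → B.Decidable r → B.Decidable (cross r)
cross? r? (inj₁ a) (inj₂ b) = r? a b
cross? r? (inj₂ b) (inj₁ a) = r? a b
cross? r? (inj₁ _) (inj₁ _) = no λ ()
cross? r? (inj₂ _) (inj₂ _) = no λ ()

cross-sym : ∀ {m} (r : REL (Fin m) (Fin m) 0ℓ) x y → cross r x y → cross r y x
cross-sym r (inj₁ a) (inj₂ b) rab = rab
cross-sym r (inj₂ b) (inj₁ a) rab = rab

cross-irrefl : ∀ {m} (r : REL (Fin m) (Fin m) 0ℓ) x → ¬ cross r x x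
cross-irrefl r (inj₁ _) ()
cross-irrefl r (inj₂ _) ()

bipartite : ∀ {m} {r : REL (Fin m) (Fin m) 0ℓ} → B.Decidable r → Graph (m + m)
bipartite {m} {r} r? = record
  { E  = λ u v → cross r (splitAt m u) (splitAt m v)
  ; E? = λ u v → cross? r? (splitAt m u) (splitAt m v)
  }

-- A view of the vertices: matching on it brings a vertex into one of the two forms for which the
-- edges are known.
data Side {m} : Fin (m + m) → Set where
  left  : ∀ a → Side (a ↑ˡ m)
  right : ∀ b → Side (m ↑ʳ b)

side : ∀ {m} (v : Fin (m + m)) → Side {m} v
side {m} v with splitAt m v | join-splitAt m m v
... | inj₁ a | refl = left a
... | inj₂ b | refl = right b

↑ˡ≢↑ʳ : ∀ {m} (a b : Fin m) → a ↑ˡ m ≢ m ↑ʳ b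
↑ˡ≢↑ʳ {m} a b eq with trans (sym (splitAt-↑ˡ m a m)) (trans (cong (splitAt m) eq) (splitAt-↑ʳ m m b))
... | ()

module _ {m} {r : REL (Fin m) (Fin m) 0ℓ} (r? : B.Decidable r) where

  -- An equality of types, because `E` is stuck on `splitAt`; edges can be transported along it in
  -- either direction.
  E-left-right : ∀ a b → E (bipartite r?) (a ↑ˡ m) (m ↑ʳ b) ≡ r a b
  E-left-right a b rewrite splitAt-↑ˡ m a m | splitAt-↑ʳ m m b = refl

  E-right-left : ∀ b a → E (bipartite r?) (m ↑ʳ b) (a ↑ˡ m) ≡ r a b
  E-right-left b a rewrite splitAt-↑ˡ m a m | splitAt-↑ʳ m m b = refl

  edge-left-right : ∀ a b → r a b → E (bipartite r?) (a ↑ˡ m) (m ↑ʳ b)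
  edge-left-right a b = subst id (sym (E-left-right a b))

  edge-right-left : ∀ b a → r a b → E (bipartite r?) (m ↑ʳ b) (a ↑ˡ m)
  edge-right-left b a = subst id (sym (E-right-left b a))

  ¬E-left-left : ∀ a a′ → ¬ E (bipartite r?) (a ↑ˡ m) (a′ ↑ˡ m)
  ¬E-left-left a a′ rewrite splitAt-↑ˡ m a m | splitAt-↑ˡ m a′ m = λ ()

  ¬E-right-right : ∀ b b′ → ¬ E (bipartite r?) (m ↑ʳ b) (m ↑ʳ b′)
  ¬E-right-right b b′ rewrite splitAt-↑ʳ m m b | splitAt-↑ʳ m m b′ = λ ()

  step-right : ∀ a b {w k} → r a b →
    Walk (bipartite r?) (m ↑ʳ b) w k → Walk (bipartite r?) (a ↑ˡ m) w (suc k)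
  step-right a b rab walk = _∷_ {v = m ↑ʳ b} (edge-left-right a b rab) walk

  step-left : ∀ b a {w k} → r a b →
    Walk (bipartite r?) (a ↑ˡ m) w k → Walk (bipartite r?) (m ↑ʳ b) w (suc k)
  step-left b a rab walk = _∷_ {v = a ↑ˡ m} (edge-right-left b a rab) walk

  -- Walks of length at most `d` between all pairs give connectedness and bound every distance, so
  -- only one pair has to be shown to be at distance exactly `d`.
  bipartite-admissible : ∀ d → d ≡ 2 ⊎ d ≡ 3 →
    (∃ λ u → ∃ λ v → IsDistance (bipartite r?) u v d) →
    (∀ u v → ∃ λ k → k ≤ d × Walk (bipartite r?) u v k) →
    Admissible (bipartite r?) d
  bipartite-admissible d 2or3 far walk = record
    { symmetric = λ {u} {v} → cross-sym r (splitAt m u) (splitAt m v)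
    ; loopless  = λ { {u} refl → cross-irrefl r (splitAt m u) }
    ; connected = λ u v → let k , _ , w = walk u v in k , w
    ; diameter  = far , λ u v k (_ , shortest) →
        let l , l≤d , w = walk u v in ≤-trans (shortest l w) l≤d
    ; 2or3      = 2or3
    }

-- The complete bipartite graph, with and without an edge

total? : ∀ m → B.Decidable {A = Fin m} {B = Fin m} (λ _ _ → ⊤)
total? m _ _ = yes tt

K : ∀ m → Graph (m + m)
K m = bipartite (total? m)

-- A disjunction rather than a negated conjunction: a surviving edge names an end at which it
-- differs from the deleted one.
except? : ∀ {m} (i j : Fin m) → B.Decidable (λ a b → a ≢ i ⊎ b ≢ j)
except? i j a b = ¬? (a ≟ᶠ i) ⊎-dec ¬? (b ≟ᶠ j)

K-minus : ∀ {m} → Fin m → Fin m → Graph (m + m)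
K-minus i j = bipartite (except? i j)

-- Two distinct vertices on the same side are not adjacent but have a common neighbour; they realise
-- the diameter.
K-admissible : ∀ {m} {x y : Fin m} → x ≢ y → Admissible (K m) 2
K-admissible {m} {x} {y} x≢y = bipartite-admissible (total? m) 2 (inj₁ refl)
  (x ↑ˡ m , y ↑ˡ m , step-right (total? m) x x tt (step-left (total? m) x y tt []) , λ k → far k refl refl)
  (λ u v → walk (side u) (side v))
  where
  -- The end points are variables tied down by equations, since matching on the empty walk would
  -- otherwise get stuck unifying `x ↑ˡ m` with `y ↑ˡ m`.
  far : ∀ {u v} k → u ≡ x ↑ˡ m → v ≡ y ↑ˡ m → Walk (K m) u v k → 2 ≤ k
  far 0 u≡ v≡ []             = contradiction (↑ˡ-injective m x y (trans (sym u≡) v≡)) x≢y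
  far 1 refl refl (e ∷ [])   = contradiction e (¬E-left-left (total? m) x y)
  far (suc (suc k)) _ _ _    = s≤s (s≤s z≤n)

  walk : ∀ {u v} → Side {m} u → Side {m} v → ∃ λ k → k ≤ 2 × Walk (K m) u v k
  walk (left a)  (left a′)  = 2 , ≤-refl , step-right (total? m) a x tt (step-left (total? m) x a′ tt [])
  walk (left a)  (right b)  = 1 , s≤s z≤n , step-right (total? m) a b tt []
  walk (right b) (left a)   = 1 , s≤s z≤n , step-left (total? m) b a tt []
  walk (right b) (right b′) = 2 , ≤-refl , step-left (total? m) b x tt (step-right (total? m) x b′ tt [])

-- The ends of the deleted edge realise the diameter: they lie on different sides, which rules out
-- paths of length 2, and the detour through `j′` and `i′` has length 3.
K-minus-admissible : ∀ {m} {i i′ j j′ : Fin m} → i′ ≢ i → j′ ≢ j → Admissible (K-minus i j) 3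
K-minus-admissible {m} {i} {i′} {j} {j′} i′≢i j′≢j = bipartite-admissible r? 3 (inj₂ refl)
  (i ↑ˡ m , m ↑ʳ j , via-other i j , λ k → far k refl refl)
  (λ u v → walk (side u) (side v))
  where
  r? = except? i j
  G = K-minus i j

  -- Every edge of this walk has `i′` or `j′` as an end, so none is the deleted one, whatever `a`
  -- and `b` are.
  via-other : ∀ a b → Walk G (a ↑ˡ m) (m ↑ʳ b) 3
  via-other a b = step-right r? a j′ (inj₂ j′≢j) (step-left r? j′ i′ (inj₁ i′≢i)
    (step-right r? i′ b (inj₁ i′≢i) []))

  no-edge : ¬ E G (i ↑ˡ m) (m ↑ʳ j)
  no-edge e with subst id (E-left-right r? i j) e
  ... | inj₁ i≢i = i≢i refl
  ... | inj₂ j≢j = j≢j refl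

  no-2-path : ∀ {x} → Side {m} x → E G (i ↑ˡ m) x → ¬ E G x (m ↑ʳ j)
  no-2-path (left a)  e _ = ¬E-left-left r? i a e
  no-2-path (right b) _ e = ¬E-right-right r? b j e

  far : ∀ {u v} k → u ≡ i ↑ˡ m → v ≡ m ↑ʳ j → Walk G u v k → 3 ≤ k
  far 0 u≡ v≡ []                 = contradiction (trans (sym u≡) v≡) (↑ˡ≢↑ʳ i j)
  far 1 refl refl (e ∷ [])       = contradiction e no-edge
  far 2 refl refl (_∷_ {v = x} e (f ∷ [])) = contradiction f (no-2-path (side x) e)
  far (suc (suc (suc k))) _ _ _  = s≤s (s≤s (s≤s z≤n))

  walk : ∀ {u v} → Side {m} u → Side {m} v → ∃ λ k → k ≤ 3 × Walk G u v k
  walk (left a)  (left a′)  = 2 , s≤s (s≤s z≤n) ,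
    step-right r? a j′ (inj₂ j′≢j) (step-left r? j′ a′ (inj₂ j′≢j) [])
  walk (left a)  (right b)  = 3 , ≤-refl , via-other a b
  walk (right b) (left a)   = 3 , ≤-refl ,
    step-left r? b i′ (inj₁ i′≢i) (step-right r? i′ j′ (inj₁ i′≢i)
      (step-left r? j′ a (inj₂ j′≢j) []))
  walk (right b) (right b′) = 2 , s≤s (s≤s z≤n) ,
    step-left r? b i′ (inj₁ i′≢i) (step-right r? i′ b′ (inj₁ i′≢i) [])

-- How many deleted edges an operation can detect

OnlyOne : ∀ {m n} → (Fin m → Fin n) → Subset n → Fin m → Set
OnlyOne f S x = f x ∈ S × (∀ y → f y ∈ S → y ≡ x)

onlyOne? : ∀ {m n} (f : Fin m → Fin n) S → Decidable (OnlyOne f S)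
onlyOne? f S x = (f x ∈? S) ×-dec all? (λ y → (f y ∈? S) →-dec (y ≟ᶠ x))

another : ∀ {m n} (f : Fin m → Fin n) S x → ¬ OnlyOne f S x → f x ∈ S →
  ∃ λ y → y ≢ x × f y ∈ S
another f S x ¬only fx∈S with ¬∀⟶∃¬ _ _ (λ y → (f y ∈? S) →-dec (y ≟ᶠ x)) (λ all → ¬only (fx∈S , all))
... | y , ¬imp with f y ∈? S
...   | yes fy∈S = y , (λ y≡x → ¬imp (λ _ → y≡x)) , fy∈S
...   | no  fy∉S = contradiction (λ fy∈S → contradiction fy∈S fy∉S) ¬imp

∑-onlyOne≤1 : ∀ {m n} (f : Fin m → Fin n) S → ∑ (allFin m) (λ x → 𝟙 (onlyOne? f S x)) ≤ 1
∑-onlyOne≤1 f S = ∑-𝟙-unique (onlyOne? f S)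
  (λ (fx∈S , _) (_ , all) → all _ fx∈S) (allFin⁺ _)

-- If `s` is an end of the deleted edge, then `S` contains another vertex on the same side, and that
-- one is adjacent to `w` after the deletion. Any other `s` can be kept.
neighbour-K-minus : ∀ {m} {i j : Fin m} {S w s} →
  ¬ OnlyOne (_↑ˡ m) S i → ¬ OnlyOne (m ↑ʳ_) S j →
  Side {m} w → Side {m} s → s ∈ S → E (K m) w s →
  ∃ λ s → s ∈ S × E (K-minus i j) w s
neighbour-K-minus {m} ¬i ¬j (left a) (left a′) s∈S e =
  contradiction e (¬E-left-left (total? m) a a′)
neighbour-K-minus {m} ¬i ¬j (right b) (right b′) s∈S e =
  contradiction e (¬E-right-right (total? m) b b′)
neighbour-K-minus {m} {i} {j} {S} ¬i ¬j (left a) (right b) s∈S e with b ≟ᶠ j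
... | no  b≢j  = m ↑ʳ b , s∈S , edge-left-right (except? i j) a b (inj₂ b≢j)
... | yes refl = let b′ , b′≢j , b′∈S = another (m ↑ʳ_) S b ¬j s∈S in
  m ↑ʳ b′ , b′∈S , edge-left-right (except? i j) a b′ (inj₂ b′≢j)
neighbour-K-minus {m} {i} {j} {S} ¬i ¬j (right b) (left a) s∈S e with a ≟ᶠ i
... | no  a≢i  = a ↑ˡ m , s∈S , edge-right-left (except? i j) b a (inj₁ a≢i)
... | yes refl = let a′ , a′≢i , a′∈S = another (_↑ˡ m) S a ¬i s∈S in
  a′ ↑ˡ m , a′∈S , edge-right-left (except? i j) b a′ (inj₁ a′≢i)

K-minus⊆K : ∀ {m} (i j : Fin m) {u v} → Side {m} u → Side {m} v →
  E (K-minus i j) u v → E (K m) u v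
K-minus⊆K i j (left a) (left a′) e = contradiction e (¬E-left-left (except? i j) a a′)
K-minus⊆K i j (right b) (right b′) e = contradiction e (¬E-right-right (except? i j) b b′)
K-minus⊆K {m} i j (left a) (right b) _ = edge-left-right (total? m) a b tt
K-minus⊆K {m} i j (right b) (left a) _ = edge-right-left (total? m) b a tt

Pre-K-minus : ∀ {m} (i j : Fin m) S →
  ¬ OnlyOne (_↑ˡ m) S i → ¬ OnlyOne (m ↑ʳ_) S j → Pre (K-minus i j) S ≡ Pre (K m) S
Pre-K-minus {m} i j S ¬i ¬j = tabulate-cong λ v → does-⇔
  (mk⇔ (λ (s , s∈S , e) → s , s∈S , K-minus⊆K i j (side v) (side s) e)
       (λ (s , s∈S , e) → neighbour-K-minus {m} {i} {j} {S} ¬i ¬j (side v) (side s) s∈S e))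
  (any? λ s → (s ∈? S) ×-dec E? (K-minus i j) v s)
  (any? λ s → (s ∈? S) ×-dec E? (K m) v s)

Post≡Pre : ∀ {m} {r : REL (Fin m) (Fin m) 0ℓ} (r? : B.Decidable r) S →
  Post (bipartite r?) S ≡ Pre (bipartite r?) S
Post≡Pre {m} {r} r? S = tabulate-cong λ v → does-⇔
  (mk⇔ (λ (s , s∈S , e) → s , s∈S , cross-sym r (splitAt m s) (splitAt m v) e)
       (λ (s , s∈S , e) → s , s∈S , cross-sym r (splitAt m v) (splitAt m s) e))
  (any? λ s → (s ∈? S) ×-dec E? (bipartite r?) s v)
  (any? λ s → (s ∈? S) ×-dec E? (bipartite r?) v s)

-- An upper bound for the indicator of detection, possibly 2. Being a term in `i` plus a term in
-- `j`, it is easy to sum over all deleted edges.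
onlyOnes : ∀ {m} → Subset (m + m) → Fin m → Fin m → ℕ
onlyOnes {m} S i j = 𝟙 (onlyOne? (_↑ˡ m) S i) + 𝟙 (onlyOne? (m ↑ʳ_) S j)

detections : ∀ {m} → Request (m + m) → Fin m → Fin m → ℕ
detections (pre S)  i j = onlyOnes S i j
detections (post S) i j = onlyOnes S i j
detections toss     i j = 0

Pre-K-minus-or-onlyOnes : ∀ {m} (i j : Fin m) S →
  Pre (K-minus i j) S ≡ Pre (K m) S ⊎ 1 ≤ onlyOnes S i j
Pre-K-minus-or-onlyOnes {m} i j S with onlyOne? (_↑ˡ m) S i | onlyOne? (m ↑ʳ_) S j
... | yes _ | _     = inj₂ (s≤s z≤n)
... | no _  | yes _ = inj₂ ≤-refl
... | no ¬i | no ¬j = inj₁ (Pre-K-minus i j S ¬i ¬j)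

-- Both graphs are offered the same random bit, so a coin toss never tells them apart.
respond-or-detect : ∀ {m} (i j : Fin m) q b →
  respond (K-minus i j) q b ≡ respond (K m) q b ⊎ 1 ≤ detections q i j
respond-or-detect i j (pre S) b with Pre-K-minus-or-onlyOnes i j S
... | inj₁ eq = inj₁ (cong set eq)
... | inj₂ le = inj₂ le
respond-or-detect {m} i j (post S) b with Pre-K-minus-or-onlyOnes i j S
... | inj₁ eq = inj₁ (cong set (trans (Post≡Pre (except? i j) S) (trans eq (sym (Post≡Pre (total? m) S)))))
... | inj₂ le = inj₂ le
respond-or-detect i j toss b = inj₁ refl

-- Sums over all deleted edges

∑∑ : ∀ {m} → (Fin m → Fin m → ℕ) → ℕ
∑∑ {m} f = ∑ (allFin m) λ i → ∑ (allFin m) (f i)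

∑-allFin-const : ∀ m k → ∑ (allFin m) (λ _ → k) ≡ m * k
∑-allFin-const m k = trans (∑-const (allFin m) k) (cong (_* k) (length-tabulate {n = m} id))

∑∑-const : ∀ m k → ∑∑ {m} (λ _ _ → k) ≡ m * (m * k)
∑∑-const m k = trans (∑-cong (allFin m) (λ _ → ∑-allFin-const m k)) (∑-allFin-const m (m * k))

∑∑-mono : ∀ {m} {f g : Fin m → Fin m → ℕ} → (∀ i j → f i j ≤ g i j) → ∑∑ f ≤ ∑∑ g
∑∑-mono {m} f≤g = ∑-mono (allFin m) λ i → ∑-mono (allFin m) (f≤g i)

∑∑-+ : ∀ {m} (f g : Fin m → Fin m → ℕ) → ∑∑ (λ i j → f i j + g i j) ≡ ∑∑ f + ∑∑ g
∑∑-+ {m} f g = trans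
  (∑-cong (allFin m) (λ i → ∑-+ (allFin m) (f i) (g i)))
  (∑-+ (allFin m) (λ i → ∑ (allFin m) (f i)) (λ i → ∑ (allFin m) (g i)))

∑∑-*ˡ : ∀ {m} k (f : Fin m → Fin m → ℕ) → ∑∑ (λ i j → k * f i j) ≡ k * ∑∑ f
∑∑-*ˡ {m} k f = trans
  (∑-cong (allFin m) (λ i → ∑-*ˡ (allFin m) k (f i)))
  (∑-*ˡ (allFin m) k (λ i → ∑ (allFin m) (f i)))

∑∑-swap : ∀ {m} {X : Set} (xs : List X) (f : X → Fin m → Fin m → ℕ) →
  ∑∑ (λ i j → ∑ xs (λ x → f x i j)) ≡ ∑ xs (λ x → ∑∑ (f x))
∑∑-swap {m} xs f = trans
  (∑-cong (allFin m) (λ i → ∑-swap (allFin m) xs (λ j x → f x i j)))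
  (∑-swap (allFin m) xs (λ i x → ∑ (allFin m) (f x i)))

-- At most one `i` is the only left vertex in `S`, and it occurs in `m` pairs; likewise for `j`.
∑∑-onlyOnes : ∀ {m} (S : Subset (m + m)) → ∑∑ {m} (onlyOnes S) ≤ m + m
∑∑-onlyOnes {m} S = begin
  ∑∑ {m} (onlyOnes S)
    ≡⟨ ∑∑-+ {m} (λ i _ → p i) (λ _ j → q j) ⟩
  ∑ (allFin m) (λ i → ∑ (allFin m) (λ _ → p i)) + ∑ (allFin m) (λ _ → ∑ (allFin m) q)
    ≡⟨ cong₂ _+_ (∑-cong (allFin m) (λ i → ∑-allFin-const m (p i))) (∑-allFin-const m _) ⟩
  ∑ (allFin m) (λ i → m * p i) + m * ∑ (allFin m) q
    ≡⟨ cong (_+ m * ∑ (allFin m) q) (∑-*ˡ (allFin m) m p) ⟩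
  m * ∑ (allFin m) p + m * ∑ (allFin m) q
    ≤⟨ +-mono-≤ (*-monoʳ-≤ m (∑-onlyOne≤1 (_↑ˡ m) S)) (*-monoʳ-≤ m (∑-onlyOne≤1 (m ↑ʳ_) S)) ⟩
  m * 1 + m * 1
    ≡⟨ cong₂ _+_ (*-identityʳ m) (*-identityʳ m) ⟩
  m + m ∎
  where
  open ≤-Reasoning
  p = λ (i : Fin m) → 𝟙 (onlyOne? (_↑ˡ m) S i)
  q = λ (j : Fin m) → 𝟙 (onlyOne? (m ↑ʳ_) S j)

∑∑-detections : ∀ {m} (q : Request (m + m)) → ∑∑ {m} (detections q) ≤ cost q * (m + m)
∑∑-detections {m} (pre S)  = ≤-trans (∑∑-onlyOnes {m} S) (≤-reflexive (sym (*-identityˡ _)))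
∑∑-detections {m} (post S) = ≤-trans (∑∑-onlyOnes {m} S) (≤-reflexive (sym (*-identityˡ _)))
∑∑-detections {m} toss = ≤-reflexive (trans (∑∑-const m 0) (trans (cong (m *_) (*-zeroʳ m)) (*-zeroʳ m)))

-- Runs with the same coins on two graphs

apart : Maybe ℕ → Maybe ℕ → ℕ
apart x y = 𝟙 (¬? (≡-dec _≟_ x y))

apart-refl : ∀ x → apart x x ≡ 0
apart-refl x = 𝟙-false (¬? (≡-dec _≟_ x x)) (λ x≢x → x≢x refl)

∑∑-apart-refl : ∀ {m} (x : Maybe ℕ) → ∑∑ {m} (λ _ _ → apart x x) ≤ 0
∑∑-apart-refl {m} x rewrite apart-refl x =
  ≤-reflexive (trans (∑∑-const m 0) (trans (cong (m *_) (*-zeroʳ m)) (*-zeroʳ m)))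

-- Induction along the run on `K m`, which does not depend on `i` and `j`. A pair is charged to an
-- operation that detects it, and until then both runs share one history; each operation is charged
-- for at most `m + m` pairs.
∑∑-apart≤operations : ∀ {m t} (A : SymbolicAlgorithm) h (ω : Vec Bool t) →
  ∑∑ {m} (λ i j → apart (verdict A (K m) h ω) (verdict A (K-minus i j) h ω)) ≤
  operations A (K m) h ω * (m + m)
∑∑-apart≤operations {m} A h []ᵛ = ∑∑-apart-refl {m} nothing
∑∑-apart≤operations {m} A h (b ∷ᵛ ω) with A (m + m) h
... | halt d    = ∑∑-apart-refl {m} (just d)
... | perform q = begin
  ∑∑ {m} (λ i j → apart v (verdict A (K-minus i j) (respond (K-minus i j) q b ∷ h) ω))
    ≤⟨ ∑∑-mono {m} step ⟩
  ∑∑ {m} (λ i j → detections q i j + apart v (verdict A (K-minus i j) h′ ω))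
    ≡⟨ ∑∑-+ {m} (detections q) (λ i j → apart v (verdict A (K-minus i j) h′ ω)) ⟩
  ∑∑ {m} (detections q) + ∑∑ {m} (λ i j → apart v (verdict A (K-minus i j) h′ ω))
    ≤⟨ +-mono-≤ (∑∑-detections {m} q) (∑∑-apart≤operations {m} A h′ ω) ⟩
  cost q * (m + m) + operations A (K m) h′ ω * (m + m)
    ≡⟨ *-distribʳ-+ (m + m) (cost q) _ ⟨
  (cost q + operations A (K m) h′ ω) * (m + m) ∎
  where
  open ≤-Reasoning
  h′ = respond (K m) q b ∷ h
  v  = verdict A (K m) h′ ω
  step : ∀ (i j : Fin m) → apart v (verdict A (K-minus i j) (respond (K-minus i j) q b ∷ h) ω) ≤
                 detections q i j + apart v (verdict A (K-minus i j) h′ ω)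
  -- Either the responses agree and both runs continue from `h′`, or the detection alone pays for
  -- `apart`, which is at most 1.
  step i j with respond-or-detect i j q b
  ... | inj₁ eq = ≤-trans
    (≤-reflexive (cong (λ a → apart v (verdict A (K-minus i j) (a ∷ h) ω)) eq))
    (m≤n+m _ (detections q i j))
  ... | inj₂ le = ≤-trans (𝟙≤1 (¬? (≡-dec _≟_ v _))) (≤-trans le (m≤m+n _ _))

-- The number of coin strings leading to a given answer

answers : Maybe ℕ → ℕ → ℕ
answers x d = 𝟙 (≡-dec _≟_ x (just d))

-- Divided by `2 ^ t`, this is the probability of the answer `d` within `t` actions after the
-- history `h`; an arbitrary `h` permits recursion along the run.
count : ∀ {n} → SymbolicAlgorithm → Graph n → ℕ → History n → ℕ → ℕ
count A G d h t = ∑ (bitStrings t) λ ω → answers (verdict A G h ω) d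

∑-bitStrings-const : ∀ t k → ∑ (bitStrings t) (λ _ → k) ≡ 2 ^ t * k
∑-bitStrings-const t k = trans (∑-const (bitStrings t) k) (cong (_* k) (length-bitStrings t))

count≤2^t : ∀ {n} A (G : Graph n) d h t → count A G d h t ≤ 2 ^ t
count≤2^t A G d h t = begin
  count A G d h t                ≤⟨ ∑-mono (bitStrings t) (λ ω → 𝟙≤1 (≡-dec _≟_ (verdict A G h ω) _)) ⟩
  ∑ (bitStrings t) (λ _ → 1)     ≡⟨ ∑-bitStrings-const t 1 ⟩
  2 ^ t * 1                      ≡⟨ *-identityʳ _ ⟩
  2 ^ t                          ∎
  where open ≤-Reasoning

count-halt : ∀ {n} A (G : Graph n) d h t {d₀} → A n h ≡ halt d₀ →
  count A G d h (suc t) ≡ 2 ^ suc t * answers (just d₀) d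
count-halt A G d h t {d₀} eq = begin
  count A G d h (suc t)        ≡⟨ ∑-bitStrings t _ ⟩
  S false + S true             ≡⟨ cong₂ _+_ (S≡ false) (S≡ true) ⟩
  c + c                        ≡⟨ double (2 ^ t) (answers (just d₀) d) ⟩
  2 ^ suc t * answers (just d₀) d ∎
  where
  open ≡-Reasoning
  S = λ b → ∑ (bitStrings t) λ ω → answers (verdict A G h (b ∷ᵛ ω)) d
  c = 2 ^ t * answers (just d₀) d
  S≡ : ∀ b → S b ≡ c
  S≡ b rewrite eq = ∑-bitStrings-const t _
  double : ∀ x y → x * y + x * y ≡ 2 * x * y
  double = solve-∀

count-perform : ∀ {n} A (G : Graph n) d h t {q} → A n h ≡ perform q →
  count A G d h (suc t) ≡
  count A G d (respond G q false ∷ h) t + count A G d (respond G q true ∷ h) t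
count-perform A G d h t {q} eq = trans (∑-bitStrings t _) (cong₂ _+_ (S≡ false) (S≡ true))
  where
  S≡ : ∀ b → ∑ (bitStrings t) (λ ω → answers (verdict A G h (b ∷ᵛ ω)) d) ≡
             count A G d (respond G q b ∷ h) t
  S≡ b rewrite eq = refl

-- The probabilities of two different answers add up to at most 1, even if the
-- runs are cut off at different times (probabilities only grow with time).
count-disjoint : ∀ {n} A (G : Graph n) {d e} → d ≢ e → ∀ h s t →
  count A G d h s * 2 ^ t + count A G e h t * 2 ^ s ≤ 2 ^ s * 2 ^ t
count-disjoint A G {d} {e} d≢e h zero t = begin
  count A G e h t * 1 ≡⟨ *-identityʳ _ ⟩
  count A G e h t     ≤⟨ count≤2^t A G e h t ⟩
  2 ^ t               ≡⟨ *-identityˡ _ ⟨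
  1 * 2 ^ t           ∎
  where open ≤-Reasoning
count-disjoint A G {d} {e} d≢e h (suc s) zero = begin
  count A G d h (suc s) * 1 + 0 ≡⟨ +-identityʳ _ ⟩
  count A G d h (suc s) * 1     ≤⟨ *-monoˡ-≤ 1 (count≤2^t A G d h (suc s)) ⟩
  2 ^ suc s * 1                 ∎
  where open ≤-Reasoning
-- With both cut-offs positive, the two runs begin with the same action. Halting gives at most one
-- of the two answers; otherwise the claim is averaged over the first bit.
count-disjoint {n} A G {d} {e} d≢e h (suc s) (suc t) with A n h in eq
... | halt d₀ rewrite count-halt A G d h s eq | count-halt A G e h t eq = begin
  S * x * T + T * y * S ≡⟨ arith S T x y ⟩
  S * T * (x + y)       ≤⟨ *-monoʳ-≤ (S * T) x+y≤1 ⟩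
  S * T * 1             ≡⟨ *-identityʳ _ ⟩
  S * T                 ∎
  where
  open ≤-Reasoning
  S = 2 ^ suc s
  T = 2 ^ suc t
  x = answers (just d₀) d
  y = answers (just d₀) e
  arith : ∀ S T x y → S * x * T + T * y * S ≡ S * T * (x + y)
  arith = solve-∀
  x+y≤1 : x + y ≤ 1
  x+y≤1 with ≡-dec _≟_ (just d₀) (just d)
  ... | no _  = 𝟙≤1 (≡-dec _≟_ (just d₀) (just e))
  ... | yes p = ≤-reflexive (cong suc (𝟙-false (≡-dec _≟_ (just d₀) (just e))
                  λ p′ → d≢e (just-injective (trans (sym p) p′))))
... | perform q rewrite count-perform A G d h s eq | count-perform A G e h t eq = begin
  (d₀ + d₁) * (2 * T) + (e₀ + e₁) * (2 * S)
    ≡⟨ regroup S T d₀ d₁ e₀ e₁ ⟩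
  2 * ((d₀ * T + e₀ * S) + (d₁ * T + e₁ * S))
    ≤⟨ *-monoʳ-≤ 2 (+-mono-≤ (count-disjoint A G d≢e _ s t) (count-disjoint A G d≢e _ s t)) ⟩
  2 * (S * T + S * T)
    ≡⟨ arith S T ⟩
  2 * S * (2 * T) ∎
  where
  open ≤-Reasoning
  S = 2 ^ s
  T = 2 ^ t
  d₀ = count A G d (respond G q false ∷ h) s
  d₁ = count A G d (respond G q true ∷ h) s
  e₀ = count A G e (respond G q false ∷ h) t
  e₁ = count A G e (respond G q true ∷ h) t
  regroup : ∀ S T d₀ d₁ e₀ e₁ → (d₀ + d₁) * (2 * T) + (e₀ + e₁) * (2 * S) ≡
            2 * ((d₀ * T + e₀ * S) + (d₁ * T + e₁ * S))
  regroup = solve-∀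
  arith : ∀ S T → 2 * (S * T + S * T) ≡ 2 * S * (2 * T)
  arith = solve-∀

-- With shared coins, a string leading to `d` on `G` either leads to `d` on `G′` as well or sets the
-- two runs apart.
count-apart : ∀ {n} A (G G′ : Graph n) d t →
  count A G d [] t ≤
  ∑ (bitStrings t) (λ ω → apart (verdict A G [] ω) (verdict A G′ [] ω)) + count A G′ d [] t
count-apart A G G′ d t = ≤-trans
  (∑-mono (bitStrings t) (λ ω → triangle (verdict A G [] ω) (verdict A G′ [] ω)))
  (≤-reflexive (∑-+ (bitStrings t) _ _))
  where
  triangle : ∀ x y → answers x d ≤ apart x y + answers y d
  triangle x y with ≡-dec _≟_ x y
  ... | yes refl = ≤-refl
  ... | no  _    = ≤-trans (𝟙≤1 (≡-dec _≟_ x (just d))) (s≤s z≤n)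

-- From correctness to counts of coin strings

-- 5/8 is any constant strictly between 1/2 and 2/3.
AnswersOften : SymbolicAlgorithm → Set₁
AnswersOften A = ∀ n (G : Graph n) d → Admissible G d →
  ∃ λ t → 5 * 2 ^ t ≤ 8 * count A G d [] t

-- The fraction `+ k / d` is reduced to lowest terms, so denominators are cleared in its
-- unnormalised representative.
5/8≤k/d : ∀ k d .⦃ _ : NonZero d ⦄ → + 5 / 8 ℚ.≤ + k / d → 5 * d ≤ 8 * k
5/8≤k/d k (suc d) le with ℚᵘ.≤-respʳ-≃ (ℚ.toℚᵘ-fromℚᵘ (mkℚᵘ (+ k) d)) (ℚ.toℚᵘ-mono-≤ le)
... | *≤* le′ = subst (5 * suc d ≤_) (*-comm k 8)
  (ℤ.drop‿+≤+ (subst₂ ℤ._≤_ (sym (ℤ.pos-* 5 (suc d))) (sym (ℤ.pos-* k 8)) le′))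

boundedError⇒answersOften : ∀ {A} → DecidesBoundedError A → AnswersOften A
boundedError⇒answersOften {A} decides n G d adm
  -- The slack is chosen so that 2/3 - 1/24 = 5/8.
  with decides n G d adm (+ 1 / 24) (ℚ.positive⁻¹ (+ 1 / 24))
... | t , le = t , subst (λ c → 5 * 2 ^ t ≤ 8 * c)
  (length-filter≡∑ correct? (bitStrings t))
  (5/8≤k/d (length (filter correct? (bitStrings t))) (2 ^ t) ⦃ m^n≢0 2 t ⦄ le)
  where
  correct? : ∀ {t} → Decidable (λ (ω : Vec Bool t) → verdict A G [] ω ≡ just d)
  correct? ω = ≡-dec _≟_ (verdict A G [] ω) (just d)

deterministic⇒answersOften : ∀ {A} → DecidesDeterministically A → AnswersOften A
deterministic⇒answersOften {A} (_ , decides) n G d adm with decides n G d adm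
... | t , correct = t , ≤-trans (*-monoˡ-≤ (2 ^ t) (m≤m+n 5 3)) (≤-reflexive (cong (8 *_) (sym count≡)))
  where
  count≡ : count A G d [] t ≡ 2 ^ t
  count≡ = trans
    (∑-cong (bitStrings t) (λ ω → 𝟙-true (≡-dec _≟_ (verdict A G [] ω) (just d)) (correct ω)))
    (trans (∑-bitStrings-const t 1) (*-identityʳ _))

-- Averaging over deleted edges and coins

-- Here `T` and `U` are numbers of coin strings for two cut-offs; `a` of `T` strings answer 2 on
-- `K m`, `b` of `T` answer 2 and `c` of `U` answer 3 on `K-minus i j`, and `δ` of `T` separate the
-- graphs. From `c` at least 5/8 of `U`, `b` is at most 3/8 of `T`; with `a` at least 5/8 of `T`,
-- this leaves `δ` at least 1/4 of `T`.
apart-often : ∀ T U a b c δ → 0 < U →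
  5 * T ≤ 8 * a → 5 * U ≤ 8 * c → b * U + c * T ≤ T * U → a ≤ δ + b → T ≤ 4 * δ
apart-often T U a b c δ 0<U a-often c-often disjoint close =
  *-cancelˡ-≤ 2 (+-cancelʳ-≤ (3 * T) (2 * T) (2 * (4 * δ)) (begin
    2 * T + 3 * T             ≡⟨ *-distribʳ-+ T 2 3 ⟨
    5 * T                     ≤⟨ a-often ⟩
    8 * a                     ≤⟨ *-monoʳ-≤ 8 close ⟩
    8 * (δ + b)               ≡⟨ arith₁ δ b ⟩
    2 * (4 * δ) + 8 * b       ≤⟨ +-monoʳ-≤ (2 * (4 * δ)) b-rare ⟩
    2 * (4 * δ) + 3 * T       ∎))
  where
  open ≤-Reasoning
  arith₁ : ∀ δ b → 8 * (δ + b) ≡ 2 * (4 * δ) + 8 * b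
  arith₁ = solve-∀
  arith₂ : ∀ b c T U → 8 * b * U + 8 * c * T ≡ 8 * (b * U + c * T)
  arith₂ = solve-∀
  arith₃ : ∀ T U → 8 * (T * U) ≡ 3 * T * U + 5 * U * T
  arith₃ = solve-∀
  b-rare : 8 * b ≤ 3 * T
  b-rare = *-cancelʳ-≤ (8 * b) (3 * T) U ⦃ >-nonZero 0<U ⦄
    (+-cancelʳ-≤ (5 * U * T) _ _ (begin
      8 * b * U + 5 * U * T   ≤⟨ +-monoʳ-≤ (8 * b * U) (*-monoˡ-≤ T c-often) ⟩
      8 * b * U + 8 * c * T   ≡⟨ arith₂ b c T U ⟩
      8 * (b * U + c * T)     ≤⟨ *-monoʳ-≤ 8 disjoint ⟩
      8 * (T * U)             ≡⟨ arith₃ T U ⟩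
      3 * T * U + 5 * U * T   ∎))

-- Each of the `m * m` deleted edges is noticed by a quarter of the coin strings, so some string
-- notices a quarter of the edges. One operation accounts for at most `2 * m` of them, which forces
-- at least m/8 operations.
costly-run-on-K : ∀ A → AnswersOften A → ∀ m .⦃ _ : NonZero m ⦄ →
  Admissible (K m) 2 → (∀ (i j : Fin m) → Admissible (K-minus i j) 3) →
  ∃ λ t → ∃ λ (ω : Vec Bool t) → m + m ≤ 16 * operations A (K m) [] ω
costly-run-on-K A often m K-adm K-minus-adm with often (m + m) (K m) 2 K-adm
... | t , K-often = t , proj₁ costly , (begin
    m + m                                   ≤⟨ *-cancelˡ-≤ m m*2m≤ ⟩
    16 * ops (proj₁ costly)                 ∎)
  where
  open ≤-Reasoning
  ops : Vec Bool t → ℕ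
  ops ω = operations A (K m) [] ω
  δ : Vec Bool t → Fin m → Fin m → ℕ
  δ ω i j = apart (verdict A (K m) [] ω) (verdict A (K-minus i j) [] ω)

  δs : Fin m → Fin m → ℕ
  δs i j = ∑ (bitStrings t) (λ ω → δ ω i j)

  δ-often : ∀ i j → 2 ^ t ≤ 4 * δs i j
  δ-often i j with often (m + m) (K-minus i j) 3 (K-minus-adm i j)
  -- The cut-off `u` varies with `i` and `j`, whereas `t` comes from `K m` alone; `count-disjoint`
  -- compares the two.
  ... | u , K-minus-often =
    apart-often (2 ^ t) (2 ^ u) (count A (K m) 2 [] t) (count A (K-minus i j) 2 [] t)
      (count A (K-minus i j) 3 [] u) _ (m^n>0 2 u) K-often K-minus-often
      (count-disjoint A (K-minus i j) (λ ()) [] t u)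
      (count-apart A (K m) (K-minus i j) 2 t)

  rearrange : ∀ m T → T * (m * m) ≡ m * (m * T)
  rearrange = solve-∀

  costly : ∃ λ ω → m * m ≤ 4 * (ops ω * (m + m))
  costly = ∑-≤⇒∃-≤ (bitStrings t) _ _
    (subst (0 <_) (sym (length-bitStrings t)) (m^n>0 2 t)) (begin
    ∑ (bitStrings t) (λ _ → m * m)                 ≡⟨ ∑-bitStrings-const t (m * m) ⟩
    2 ^ t * (m * m)                                ≡⟨ rearrange m (2 ^ t) ⟩
    m * (m * 2 ^ t)                                ≡⟨ ∑∑-const m (2 ^ t) ⟨
    ∑∑ {m} (λ _ _ → 2 ^ t)                         ≤⟨ ∑∑-mono {m} δ-often ⟩
    ∑∑ {m} (λ i j → 4 * δs i j)                    ≡⟨ ∑∑-*ˡ {m} 4 δs ⟩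
    4 * ∑∑ δs                                      ≡⟨ cong (4 *_) (∑∑-swap (bitStrings t) δ) ⟩
    4 * ∑ (bitStrings t) (λ ω → ∑∑ (δ ω))
      ≤⟨ *-monoʳ-≤ 4 (∑-mono (bitStrings t) (∑∑-apart≤operations {m} A [])) ⟩
    4 * ∑ (bitStrings t) (λ ω → ops ω * (m + m))   ≡⟨ ∑-*ˡ (bitStrings t) 4 _ ⟨
    ∑ (bitStrings t) (λ ω → 4 * (ops ω * (m + m))) ∎)

  arith₁ : ∀ m → m * (m + m) ≡ 2 * (m * m)
  arith₁ = solve-∀
  arith₂ : ∀ m x → 2 * (4 * (x * (m + m))) ≡ m * (16 * x)
  arith₂ = solve-∀
  m*2m≤ : m * (m + m) ≤ m * (16 * ops (proj₁ costly))
  m*2m≤ = begin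
    m * (m + m)                             ≡⟨ arith₁ m ⟩
    2 * (m * m)                             ≤⟨ *-monoʳ-≤ 2 (proj₂ costly) ⟩
    2 * (4 * (ops (proj₁ costly) * (m + m))) ≡⟨ arith₂ m (ops (proj₁ costly)) ⟩
    m * (16 * ops (proj₁ costly))           ∎

-- The bound over the rationals

-- Stated for variables x and y because unfolding fromℕ on an open term is very slow.
1/16*-≤ : ∀ {n k} x y → toℚᵘ x ℚᵘ.≃ mkℚᵘ (+ n) 0 → toℚᵘ y ℚᵘ.≃ mkℚᵘ (+ k) 0 →
  n ≤ 16 * k → (+ 1 / 16) ℚ.* x ℚ.≤ y
1/16*-≤ {n} {k} x y x≃n y≃k n≤16k = ℚ.toℚᵘ-cancel-≤ (begin
  toℚᵘ ((+ 1 / 16) ℚ.* x)          ≃⟨ ℚ.toℚᵘ-homo-* (+ 1 / 16) x ⟩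
  mkℚᵘ (+ 1) 15 ℚᵘ.* toℚᵘ x        ≃⟨ ℚᵘ.*-congˡ {mkℚᵘ (+ 1) 15} x≃n ⟩
  mkℚᵘ (+ 1) 15 ℚᵘ.* mkℚᵘ (+ n) 0  ≤⟨ *≤* (subst₂ ℤ._≤_ lhs (ℤ.pos-* k 16)
                                        (ℤ.+≤+ (≤-trans n≤16k (≤-reflexive (*-comm 16 k))))) ⟩
  mkℚᵘ (+ k) 0                     ≃⟨ y≃k ⟨
  toℚᵘ y                           ∎)
  where
  open ℚᵘ.≤-Reasoning
  lhs : + n ≡ (+ 1 ℤ.* + n) ℤ.* + 1
  lhs = sym (trans (ℤ.*-identityʳ _) (ℤ.*-identityˡ (+ n)))

fromℕ-≤-1/16 : ∀ n k → n ≤ 16 * k → (+ 1 / 16) ℚ.* fromℕ n ℚ.≤ fromℕ k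
fromℕ-≤-1/16 n k = 1/16*-≤ (fromℕ n) (fromℕ k)
  (ℚ.toℚᵘ-fromℚᵘ (mkℚᵘ (+ n) 0)) (ℚ.toℚᵘ-fromℚᵘ (mkℚᵘ (+ k) 0))

mainTheorem8 : ∃ λ (c : ℚ) → 0ℚ ℚ.< c ×
    (∀ (A : SymbolicAlgorithm) →
    DecidesBoundedError A ⊎ DecidesDeterministically A →
    ∀ (N : ℕ) → ∃ λ (n : ℕ) → N ≤ n ×
    (∃ λ (G : Graph n) → (∃ λ d → Admissible G d) ×
    (∃ λ (t : ℕ) → ∃ λ (ω : Vec Bool t) →
    c ℚ.* fromℕ n ℚ.≤ fromℕ (operations A G [] ω))))
mainTheorem8 = + 1 / 16 , ℚ.positive⁻¹ (+ 1 / 16) , λ A decides N →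
  -- Each side has at least two vertices, as both diameters require. With n = 2m vertices, m/8
  -- operations are n/16, whence the constant.
  let m = 2 + N
      t , ω , costly = costly-run-on-K A (answersOften A decides) m (K-adm N)
        -- The vertices `punchIn i zero` and `punchIn j zero` serve as `i′` and `j′`.
        (λ i j → K-minus-admissible (punchInᵢ≢i i zero) (punchInᵢ≢i j zero))
  in m + m , ≤-trans (m≤n+m N 2) (m≤m+n m m) ,
     K m , (2 , K-adm N) , t , ω , fromℕ-≤-1/16 (m + m) (operations A (K m) [] ω) costly
  where
  K-adm : ∀ N → Admissible (K (2 + N)) 2
  K-adm N = K-admissible {x = zero} {suc zero} λ ()

  answersOften : ∀ A → DecidesBoundedError A ⊎ DecidesDeterministically A → AnswersOften A
  answersOften A (inj₁ bounded)       = boundedError⇒answersOften bounded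
  answersOften A (inj₂ deterministic) = deterministic⇒answersOften deterministic
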